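{- Let $G$ be a connected graph with $|L(G)|\geq 4$, and let $i\in\{0,1,2\}$. Assume that it is not the case that simultaneously $i=0$, $|L_o(G)|=3$ and $|L_e(G)|=2$. If $w(G)\leq |L(G)|+i$, then $\chi(G)\leq |L(G)|+i$.
   Context: All graphs are finite, simple and undirected. $L(G)$ denotes the set of all integers $m$ such that $G$ contains a cycle of length $m$; $L_o(G)$ and $L_e(G)$ denote the sets of odd, respectively even, elements of $L(G)$. $w(G)$ denotes the clique number of $G$ (the number of vertices of a largest clique) and $\chi(G)$ the chromatic number. -}

module Defs where

open import Data.Empty using (⊥)
open import Data.Fin using (Fin; _≟_)
open import Data.Fin.Properties using (any?; all?; injective⇒≤)
open import Data.Fin.Subset using (Subset; _∈_; ∣_∣) renaming (⊥ to ∅)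
open import Data.Fin.Subset.Properties using (_∈?_; anySubset?; ∣p∣≤n; ∉⊥; ∣⊥∣≡0)
open import Data.List using (List; length; filter; upTo)
import Data.List.Membership.Propositional as List
open import Data.List.Membership.Propositional.Properties
  using (∈-filter⁺; ∈-filter⁻; ∈-upTo⁺)
import Data.List.Relation.Unary.Unique.Propositional as List
import Data.List.Relation.Unary.Unique.Propositional.Properties as List
open import Data.Nat using (ℕ; zero; suc; _≤_; z≤n; s≤s; s≤s⁻¹; _≤?_)
import Data.Nat as ℕ
open import Data.Nat.Divisibility using (_∣_; _∤_; _∣?_)
open import Data.Nat.Properties using (≤∧≢⇒<)
open import Data.Product using (∃; ∃-syntax; _×_; _,_; proj₁; proj₂)
open import Data.Vec using (Vec; []; _∷_; _∷ʳ_; lookup; tabulate)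
open import Data.Vec.Properties using (lookup∘tabulate)
open import Data.Vec.Relation.Unary.AllPairs using (allPairs?)
open import Data.Vec.Relation.Unary.Linked using (Linked; linked?)
open import Data.Vec.Relation.Unary.Unique.Propositional using (Unique)
open import Data.Vec.Relation.Unary.Unique.Propositional.Properties
  using (lookup-injective)
open import Function using (id; _∘_; _⇔_; mk⇔)
open import Level using (0ℓ)
open import Relation.Binary using (Rel; Symmetric; Irreflexive)
import Relation.Binary as Binary
open import Relation.Binary.Construct.Closure.ReflexiveTransitive using (Star)
open import Relation.Binary.PropositionalEquality
  using (_≡_; _≢_; refl; sym; subst₂)
open import Relation.Nullary using (Dec; yes; no; contradiction)
open import Relation.Nullary.Decidable using (map′; _×-dec_; _→-dec_; ¬?)
open import Relation.Unary using (Pred; Decidable; _∩_)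
open import Relation.Unary.Properties using (_∩?_)

IsLeast : Pred ℕ 0ℓ → Pred ℕ 0ℓ
IsLeast P k = P k × (∀ j → P j → k ≤ j)

IsGreatest : Pred ℕ 0ℓ → Pred ℕ 0ℓ
IsGreatest P k = P k × (∀ j → P j → j ≤ k)

least : ∀ {P} → Decidable P → ∀ b → P b → ∃ (IsLeast P)
least P? b Pb with P? 0
least P? b       Pb | yes P0 = 0 , P0 , λ _ _ → z≤n
least P? zero    Pb | no ¬P0 = contradiction Pb ¬P0
least P? (suc b) Pb | no ¬P0 with k , Pk , k≤ ← least (P? ∘ suc) b Pb =
  suc k , Pk , λ where
    zero    P0 → contradiction P0 ¬P0
    (suc j) Pj → s≤s (k≤ j Pj)

greatest : ∀ {P} → Decidable P → ∀ b → P 0 → (∀ j → P j → j ≤ b) →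
           ∃ (IsGreatest P)
greatest P? b P0 ≤b with P? b
greatest P? b       P0 ≤b | yes Pb = b , Pb , ≤b
greatest P? zero    P0 ≤b | no ¬P0 = contradiction P0 ¬P0
greatest P? (suc b) P0 ≤b | no ¬Pb = greatest P? b P0 λ j Pj →
  s≤s⁻¹ (≤∧≢⇒< (≤b j Pj) λ { refl → ¬Pb Pj })

record Finite (P : Pred ℕ 0ℓ) : Set where
  field
    elements  : List ℕ
    unique    : List.Unique elements
    ∈elements : ∀ m → m List.∈ elements ⇔ P m

  size : ℕ
  size = length elements

finite : ∀ {P} → Decidable P → ∀ b → (∀ m → P m → m ≤ b) → Finite P
finite P? b ≤b = record
  { elements  = filter P? (upTo (suc b))
  ; unique    = List.filter⁺ P? (List.upTo⁺ (suc b))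
  ; ∈elements = λ m → mk⇔
      (proj₂ ∘ ∈-filter⁻ P? {xs = upTo (suc b)})
      (λ Pm → ∈-filter⁺ P? (∈-upTo⁺ (s≤s (≤b m Pm))) Pm)
  }

anyVec? : ∀ {k} n {P : Pred (Vec (Fin k) n) 0ℓ} → Decidable P → Dec (∃ P)
anyVec? zero    P? = map′ ([] ,_) (λ { ([] , p) → p }) (P? [])
anyVec? (suc n) P? = map′
  (λ { (x , xs , p) → x ∷ xs , p })
  (λ { (x ∷ xs , p) → x , xs , p })
  (any? λ x → anyVec? n (P? ∘ (x ∷_)))

Even Odd : Pred ℕ 0ℓ
Even m = 2 ∣ m
Odd  m = 2 ∤ m

record Graph (n : ℕ) : Set₁ where
  field
    Adj    : Rel (Fin n) 0ℓ
    adj?   : Binary.Decidable Adj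
    symm   : Symmetric Adj
    irrefl : Irreflexive _≡_ Adj

module _ {n} (G : Graph n) where
  open Graph G

  Connected : Set
  Connected = ∀ u v → Star Adj u v

  IsCycle : ∀ {m} → Vec (Fin n) m → Set
  IsCycle []            = ⊥
  IsCycle {m} c@(v ∷ _) = 3 ≤ m × Unique c × Linked Adj (c ∷ʳ v)

  isCycle? : ∀ {m} → Decidable (IsCycle {m})
  isCycle? []            = no id
  isCycle? {m} c@(v ∷ _) =
    (3 ≤? m) ×-dec allPairs? (λ x y → ¬? (x ≟ y)) c ×-dec linked? adj? (c ∷ʳ v)

  L Lₒ Lₑ : Pred ℕ 0ℓ
  L m = ∃[ c ] IsCycle {m} c
  Lₒ  = L ∩ Odd
  Lₑ  = L ∩ Even

  L? : Decidable L
  L? m = anyVec? m isCycle?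

  L-bounded : ∀ m → L m → m ≤ n
  L-bounded m (c@(_ ∷ _) , _ , c! , _) =
    injective⇒≤ {f = lookup c} (lookup-injective c! _ _)

  L-finite : Finite L
  L-finite = finite L? n L-bounded

  Lₒ-finite : Finite Lₒ
  Lₒ-finite = finite (L? ∩? (¬? ∘ (2 ∣?_))) n (λ m → L-bounded m ∘ proj₁)

  Lₑ-finite : Finite Lₑ
  Lₑ-finite = finite (L? ∩? (2 ∣?_)) n (λ m → L-bounded m ∘ proj₁)

  ∣L∣ ∣Lₒ∣ ∣Lₑ∣ : ℕ
  ∣L∣  = Finite.size L-finite
  ∣Lₒ∣ = Finite.size Lₒ-finite
  ∣Lₑ∣ = Finite.size Lₑ-finite

  IsClique : Pred (Subset n) 0ℓ
  IsClique S = ∀ u v → u ∈ S → v ∈ S → u ≢ v → Adj u v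

  HasClique : Pred ℕ 0ℓ
  HasClique k = ∃[ S ] IsClique S × ∣ S ∣ ≡ k

  hasClique? : Decidable HasClique
  hasClique? k = anySubset? λ S →
    (all? λ u → all? λ v →
      (u ∈? S) →-dec (v ∈? S) →-dec ¬? (u ≟ v) →-dec adj? u v)
    ×-dec (∣ S ∣ ℕ.≟ k)

  largestClique : ∃ (IsGreatest HasClique)
  largestClique = greatest hasClique? n
    (∅ , (λ _ _ u∈∅ → contradiction u∈∅ ∉⊥) , ∣⊥∣≡0 n)
    (λ { _ (S , _ , refl) → ∣p∣≤n S })

  w : ℕ
  w = proj₁ largestClique

  IsColouring : ∀ {k} → Pred (Fin n → Fin k) 0ℓ
  IsColouring f = ∀ u v → Adj u v → f u ≢ f v

  Colourable : Pred ℕ 0ℓ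
  Colourable k = ∃[ f ] IsColouring {k} f

  colourable? : Decidable Colourable
  colourable? k = map′
    (λ { (c , p) → lookup c , p })
    (λ { (f , p) → tabulate f , λ u v uv →
         subst₂ _≢_ (sym (lookup∘tabulate f u)) (sym (lookup∘tabulate f v))
           (p u v uv) })
    (anyVec? n λ c → all? λ u → all? λ v →
      adj? u v →-dec ¬? (lookup c u ≟ lookup c v))

  fewestColours : ∃ (IsLeast Colourable)
  fewestColours = least colourable? n (id , λ _ _ uv u≡v → irrefl u≡v uv)

  χ : ℕ
  χ = proj₁ fewestColours

{-# OPTIONS --safe #-}
module Submission where

-- Let d = |L| + i and suppose that G is not d-colourable. Take a minimal vertex set S that
-- is not d-colourable and a longest path v₀ v₁ … in S. Its end v₀ has at least d neighbours,
-- all on the path. Put A = { a : v₀ ~ vₐ₊₁ } and T = L − 2. Differences of elements of A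
-- lie in T, and |T| ≤ d ≤ |A|, so A contains all of T ∪ {0} except at most one element.
-- The same holds for the longest paths vₐ … v₀ vₐ₊₁ … (a ∈ A). Moreover, no vertex
-- of S has all its neighbours in S adjacent to another vertex of S, by minimality.
-- If G has a triangle (1 ∈ T), these facts force 0, …, d − 1 ∈ A for every longest path,
-- which makes v₀, …, v_d a clique. Otherwise they force all cycle lengths to be even, and
-- then the connected graph G is bipartite.

open import Defs
open import Data.Fin using (Fin; toℕ; fromℕ<) renaming (zero to 0F; suc to sucF)
import Data.Fin as Fin
open import Data.Fin.Properties
  using (any?; toℕ<n; toℕ-fromℕ<; toℕ-injective; injective⇒≤)
import Data.Fin.Properties as Fin
open import Data.Fin.Subset using (Subset; _∈_; ∣_∣; _-_) renaming (⊤ to full)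
open import Data.Fin.Subset.Properties
  using (_∈?_; nonempty?; ∈⊤; x∈p∧x≢y⇒x∈p-y; x∈p⇒∣p-x∣<∣p∣)
open import Data.List using (List; []; _∷_; length)
import Data.List.Membership.Propositional as List
open import Data.List.Membership.Propositional.Properties using (∈-upTo⁺)
import Data.List.Membership.Setoid.Properties as Membership
open import Data.List.Properties using (length-upTo)
open import Data.List.Relation.Unary.Any using (here; there; index)
open import Data.Nat
  using (ℕ; zero; suc; _+_; _∸_; _≤_; _<_; _≤?_; _<?_; _≟_; z≤n; s≤s; s≤s⁻¹)
open import Data.List.Membership.DecPropositional _≟_ using () renaming (_∈?_ to _∈ᴸ?_)
open import Data.Nat.Divisibility
  using (_∣_; _∤_; _∣?_; divides; ∣m∣n⇒∣m+n; ∣m+n∣m⇒∣n; ∣1⇒≡1)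
open import Data.Nat.Induction using (<-rec)
open import Data.Nat.Properties hiding (_≟_)
open import Data.Product using (∃; ∃-syntax; Σ-syntax; _×_; _,_; proj₁; proj₂)
open import Data.Sum using (_⊎_; inj₁; inj₂; [_,_]′)
open import Data.Empty using (⊥; ⊥-elim)
open import Data.Vec using ([]; _∷_; _∷ʳ_; tabulate)
open import Data.Vec.Functional using () renaming (_∷_ to _∷ᶠ_)
open import Data.Vec.Properties using (lookup⇒[]=; []=⇒lookup; lookup∘tabulate)
open import Data.Vec.Relation.Unary.Linked using (Linked; []; [-]; _∷_)
import Data.Vec.Relation.Unary.Unique.Propositional.Properties as Unique
open import Function using (_∘_; case_of_; Injective; Equivalence)
open import Relation.Binary using (tri<; tri≈; tri>)
open import Relation.Binary.Construct.Closure.ReflexiveTransitive using (Star; ε; _◅_)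
open import Relation.Binary.PropositionalEquality
  using (_≡_; _≢_; refl; sym; trans; cong; subst; subst₂; ≢-sym; setoid)
open import Relation.Nullary using (Dec; yes; no; does; ¬_; contradiction)
open import Relation.Nullary.Decidable using (_×-dec_; dec-true; decidable-stable)

private
  variable
    m n : ℕ

-- Counting by injections, downward induction and parity.

injection⇒≤length : ∀ {f : Fin m → ℕ} {xs : List ℕ} → Injective _≡_ _≡_ f →
                    (∀ i → f i List.∈ xs) → m ≤ length xs
injection⇒≤length {xs = xs} inj f∈ =
  injective⇒≤ {f = index ∘ f∈} (inj ∘ Membership.index-injective (setoid ℕ) (f∈ _) (f∈ _))

injection⇒≤∣p∣ : ∀ {m} {f : Fin m → Fin n} (p : Subset n) → Injective _≡_ _≡_ f →
                 (∀ i → f i ∈ p) → m ≤ ∣ p ∣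
injection⇒≤∣p∣ {m = zero}  p inj f∈ = z≤n
injection⇒≤∣p∣ {m = suc m} {f} p inj f∈ = ≤-<-trans
  (injection⇒≤∣p∣ (p - f 0F) (Fin.suc-injective ∘ inj)
    (λ i → x∈p∧x≢y⇒x∈p-y (f∈ (sucF i)) (λ eq → case inj eq of λ ())))
  (x∈p⇒∣p-x∣<∣p∣ (f∈ 0F))

∷-injective : ∀ {f : Fin m → ℕ} {x} → (∀ i → x ≢ f i) → Injective _≡_ _≡_ f →
              Injective _≡_ _≡_ (x ∷ᶠ f)
∷-injective new inj {0F}     {0F}     _  = refl
∷-injective new inj {0F}     {sucF j} eq = contradiction eq (new j)
∷-injective new inj {sucF i} {0F}     eq = contradiction (sym eq) (new i)
∷-injective new inj {sucF i} {sucF j} eq = cong sucF (inj eq)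

descend : ∀ {P : ℕ → Set} {k} → (∀ {i} → i < k → P (suc i) → P i) → P k →
          ∀ {j} → j ≤ k → P j
descend {k = zero}      down Pk z≤n = Pk
descend {P} {k = suc k} down Pk j≤1+k with m≤n⇒m<n∨m≡n j≤1+k
... | inj₁ j≤k  = descend {P} (down ∘ m≤n⇒m≤1+n) (down ≤-refl Pk) (s≤s⁻¹ j≤k)
... | inj₂ refl = Pk

2∤⇒2∣suc : ∀ m → 2 ∤ m → 2 ∣ suc m
2∤⇒2∣suc zero          2∤m = contradiction (divides 0 refl) 2∤m
2∤⇒2∣suc (suc zero)    2∤m = divides 1 refl
2∤⇒2∣suc (suc (suc m)) 2∤m = ∣m∣n⇒∣m+n {m = 2} (divides 1 refl)
  (2∤⇒2∣suc m (2∤m ∘ ∣m∣n⇒∣m+n {m = 2} (divides 1 refl)))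

2∤1+even : 2 ∣ m → 2 ∤ suc m
2∤1+even {m} 2∣m 2∣1+m =
  case ∣1⇒≡1 (∣m+n∣m⇒∣n (subst (2 ∣_) (+-comm 1 m) 2∣1+m) 2∣m) of λ ()

module _ (G : Graph n) where
  open Graph G

  -- Cycles given by functions, counting cycle lengths, and cliques.

  linked-tabulate : ∀ k (c : ℕ → Fin n) x →
    (∀ {i} → suc i < k → Adj (c i) (c (suc i))) →
    (∀ {i} → suc i ≡ k → Adj (c i) x) →
    Linked Adj (tabulate {n = k} (c ∘ toℕ) ∷ʳ x)
  linked-tabulate zero          c x step close = [-]
  linked-tabulate (suc zero)    c x step close = close refl ∷ [-]
  linked-tabulate (suc (suc k)) c x step close =
    step (s≤s (s≤s z≤n)) ∷
    linked-tabulate (suc k) (c ∘ suc) x (step ∘ s≤s) (close ∘ cong suc)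

  cycle : ∀ k (c : ℕ → Fin n) → 2 ≤ k →
    (∀ {i j} → i ≤ k → j ≤ k → c i ≡ c j → i ≡ j) →
    (∀ {i} → i < k → Adj (c i) (c (suc i))) →
    Adj (c k) (c 0) → L G (suc k)
  cycle k c 2≤k inj step close =
    tabulate (c ∘ toℕ) , s≤s 2≤k ,
    Unique.tabulate⁺ (λ {i} {j} → toℕ-injective ∘ inj (s≤s⁻¹ (toℕ<n i)) (s≤s⁻¹ (toℕ<n j))) ,
    linked-tabulate (suc k) c (c 0) (step ∘ s≤s⁻¹) λ { refl → close }

  L⇒3≤ : ∀ {l} → L G l → 3 ≤ l
  L⇒3≤ ((_ ∷ _) , 3≤l , _) = 3≤l

  -- The extra 1 pays for the value 0: it becomes the length 2, which is put in front of the list of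
  -- cycle lengths.
  ∣L∣-bound : ∀ {f : Fin m → ℕ} → Injective _≡_ _≡_ f →
              (∀ i → f i ≡ 0 ⊎ L G (2 + f i)) → m ≤ suc (∣L∣ G)
  ∣L∣-bound {f = f} inj f∈ = injection⇒≤length {f = (2 +_) ∘ f} {xs = 2 ∷ elements}
    (inj ∘ +-cancelˡ-≡ 2 _ _)
    (λ i → [ here ∘ cong (2 +_) , there ∘ Equivalence.from (∈elements _) ]′ (f∈ i))
    where open Finite (L-finite G)

  clique⇒≤w : ∀ (f : Fin m → Fin n) → (∀ i j → i ≢ j → Adj (f i) (f j)) → m ≤ w G
  clique⇒≤w {m = m} f f-clique = ≤-trans
    (injection⇒≤∣p∣ image f-inj λ i → in-image (i , refl))
    (proj₂ (proj₂ (largestClique G)) _ (image , image-clique , refl))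
    where
    image : Subset n
    image = tabulate λ x → does (any? λ i → f i Fin.≟ x)

    -- Adjacency is irreflexive, so pairwise adjacent vertices are distinct.
    f-inj : Injective _≡_ _≡_ f
    f-inj {i} {j} eq with i Fin.≟ j
    ... | yes i≡j = i≡j
    ... | no  i≢j = contradiction (f-clique i j i≢j) (irrefl eq)

    in-image : ∀ {x} → ∃[ i ] f i ≡ x → x ∈ image
    in-image {x} p = lookup⇒[]= x image
      (trans (lookup∘tabulate _ x) (dec-true (any? λ i → f i Fin.≟ x) p))

    preimage : ∀ {x} → x ∈ image → ∃[ i ] f i ≡ x
    preimage {x} x∈
      with any? (λ i → f i Fin.≟ x)
         | trans (sym (lookup∘tabulate (λ x → does (any? λ i → f i Fin.≟ x)) x))
                 ([]=⇒lookup x∈)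
    ... | yes p | _ = p

    image-clique : IsClique G image
    image-clique u v u∈ v∈ u≢v with i , refl ← preimage u∈ | j , refl ← preimage v∈ =
      f-clique i j (u≢v ∘ cong f)

  -- Closed walks and bipartiteness.

  ClosedWalk : ℕ → (ℕ → Fin n) → Set
  ClosedWalk k c = c k ≡ c 0 × (∀ {i} → i < k → Adj (c i) (c (suc i)))

  inner-walk : ∀ i e r {c} → ClosedWalk (i + (e + r)) c → c (i + e) ≡ c i →
               ClosedWalk e λ t → c (i + t)
  inner-walk i e r {c} (_ , step) ci+e≡ci =
    trans ci+e≡ci (cong c (sym (+-identityʳ i))) ,
    λ {t} t<e → subst (Adj (c (i + t)) ∘ c) (sym (+-suc i t))
      (step (+-monoʳ-< i (<-≤-trans t<e (m≤m+n e r))))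

  -- Skipping the `e` steps that return to `c i` leaves a closed walk. Together with `inner-walk`
  -- this splits a closed walk at a repeated vertex.
  outer-walk : ∀ i e r {c} → ClosedWalk (i + (e + r)) c → c (i + e) ≡ c i →
               ∃ (ClosedWalk (i + r))
  outer-walk i e r {c} (close , step) ci+e≡ci =
    c′ , trans (c′-≥ (m≤m+n i r)) (trans (cong c shift) (trans close (sym c′-0))) , step′
    where
    c′ : ℕ → Fin n
    c′ t with t <? i
    ... | yes _ = c t
    ... | no  _ = c (t + e)

    c′-< : ∀ {t} → t < i → c′ t ≡ c t
    c′-< {t} t<i with t <? i
    ... | yes _   = refl
    ... | no  t≮i = contradiction t<i t≮i

    c′-≥ : ∀ {t} → i ≤ t → c′ t ≡ c (t + e)
    c′-≥ {t} i≤t with t <? i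
    ... | yes t<i = contradiction i≤t (<⇒≱ t<i)
    ... | no  _   = refl

    c′-≤ : ∀ {t} → t ≤ i → c′ t ≡ c t
    c′-≤ t≤i with m≤n⇒m<n∨m≡n t≤i
    ... | inj₁ t<i  = c′-< t<i
    ... | inj₂ refl = trans (c′-≥ ≤-refl) ci+e≡ci

    c′-0 : c′ 0 ≡ c 0
    c′-0 = c′-≤ z≤n

    shift : i + r + e ≡ i + (e + r)
    shift = trans (+-assoc i r e) (cong (i +_) (+-comm r e))

    step′ : ∀ {t} → t < i + r → Adj (c′ t) (c′ (suc t))
    step′ {t} t<i+r with t <? i
    ... | yes t<i = subst (Adj (c t)) (sym (c′-≤ t<i))
      (step (<-≤-trans t<i (m≤m+n i (e + r))))
    ... | no  t≮i = subst (Adj (c (t + e))) (sym (c′-≥ (m≤n⇒m≤1+n (≮⇒≥ t≮i))))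
      (step (subst (t + e <_) shift (+-monoˡ-< e t<i+r)))

  -- A repeated vertex splits the walk into two shorter closed walks, even by induction, whose
  -- lengths add up to `k`. Without repetition the walk is a cycle. Length 1 would be a loop, and
  -- length 2 is even anyway.
  even-closed-walk : (∀ l → L G l → 2 ∣ l) → ∀ k {c} → ClosedWalk k c → 2 ∣ k
  even-closed-walk 2∣L = <-rec _ walk-even
    where
    walk-even : ∀ k → (∀ {j} → j < k → ∀ {c} → ClosedWalk j c → 2 ∣ j) →
                ∀ {c} → ClosedWalk k c → 2 ∣ k
    walk-even zero                IH _              = divides 0 refl
    walk-even (suc zero)          IH (close , step) =
      contradiction (step (s≤s z≤n)) (irrefl (sym close))
    walk-even (suc (suc zero))    IH _              = divides 1 refl
    walk-even k@(suc (suc (suc k′))) IH {c} W@(close , step) with 2 ∣? k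
    ... | yes 2∣k = 2∣k
    ... | no  2∤k = 2∣L k
      (cycle (suc (suc k′)) c (s≤s (s≤s z≤n)) injective (step ∘ m≤n⇒m≤1+n)
        (subst (Adj (c (suc (suc k′)))) close (step ≤-refl)))
      where
      no-repeat : ∀ {i j} → i < j → j < k → c i ≢ c j
      no-repeat {i} {j} i<j j<k ci≡cj
        with e , refl ← m≤n⇒∃[o]m+o≡n (<⇒≤ i<j)
        with r , k≡ ← m≤n⇒∃[o]m+o≡n (<⇒≤ j<k) =
        2∤k (subst (2 ∣_) total (∣m∣n⇒∣m+n
          (IH (≤-<-trans (m≤n+m e i) j<k) (inner-walk i e r W′ (sym ci≡cj)))
          (IH shorter (proj₂ (outer-walk i e r W′ (sym ci≡cj))))))
        where
        k≡i+[e+r] : k ≡ i + (e + r)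
        k≡i+[e+r] = trans (sym k≡) (+-assoc i e r)

        W′ : ClosedWalk (i + (e + r)) c
        W′ = subst (λ k → ClosedWalk k c) k≡i+[e+r] W

        total : e + (i + r) ≡ k
        total = trans (sym (+-assoc e i r)) (trans (cong (_+ r) (+-comm e i)) k≡)

        shorter : i + r < k
        shorter = subst (i + r <_) total
          (m<n+m (i + r) (+-cancelˡ-< i 0 e (subst (_< i + e) (sym (+-identityʳ i)) i<j)))

      injective : ∀ {i j} → i ≤ 2 + k′ → j ≤ 2 + k′ → c i ≡ c j → i ≡ j
      injective {i} {j} i≤ j≤ ci≡cj with <-cmp i j
      ... | tri< i<j _ _ = contradiction ci≡cj (no-repeat i<j (s≤s j≤))
      ... | tri≈ _ i≡j _ = i≡j
      ... | tri> _ _ j<i = contradiction (sym ci≡cj) (no-repeat j<i (s≤s i≤))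

  data Walk : ℕ → Fin n → Fin n → Set where
    []  : ∀ {u} → Walk 0 u u
    _∷_ : ∀ {k u v x} → Adj u v → Walk k v x → Walk (suc k) u x

  fromStar : ∀ {u v} → Star Adj u v → ∃[ k ] Walk k u v
  fromStar ε       = 0 , []
  fromStar (e ◅ p) = suc _ , e ∷ proj₂ (fromStar p)

  reverse-append : ∀ {a b u v x} → Walk a v u → Walk b v x → Walk (a + b) u x
  reverse-append []                    q = q
  reverse-append {suc a} {b} {u} {x = x} (e ∷ p) q =
    subst (λ k → Walk k u x) (+-suc a b) (reverse-append p (symm e ∷ q))

  vertex : ∀ {k u v} → Walk k u v → ℕ → Fin n
  vertex {u = u} p       zero    = u
  -- A default value past the end; walks of length `k` are only read at positions up to `k`.
  vertex {u = u} []      (suc i) = u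
  vertex         (e ∷ p) (suc i) = vertex p i

  vertex-last : ∀ {k u v} (p : Walk k u v) → vertex p k ≡ v
  vertex-last []      = refl
  vertex-last (e ∷ p) = vertex-last p

  vertex-step : ∀ {k u v} (p : Walk k u v) {i} → i < k → Adj (vertex p i) (vertex p (suc i))
  vertex-step (e ∷ [])      {zero}  _         = e
  vertex-step (e ∷ (_ ∷ _)) {zero}  _         = e
  vertex-step (e ∷ p)       {suc i} (s≤s i<k) = vertex-step p i<k

  -- Vertices are coloured by the parity of a walk from `r`. An edge and the walks to its two ends
  -- form a closed walk, which is even, so the two parities differ. Here `dist` is the length of the
  -- walk that connectivity supplies, not the graph distance.
  even-cycles⇒2-colourable : Connected G → Fin n → (∀ l → L G l → 2 ∣ l) → Colourable G 2
  even-cycles⇒2-colourable conn r 2∣L = f , proper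
    where
    dist : Fin n → ℕ
    dist u = proj₁ (fromStar (conn r u))

    f : Fin n → Fin 2
    f u with 2 ∣? dist u
    ... | yes _ = 0F
    ... | no  _ = sucF 0F

    total-odd : ∀ u v → Adj u v → 2 ∣ suc (dist u + dist v)
    total-odd u v uv = even-closed-walk 2∣L _
      (vertex-last W , vertex-step W)
      where
      W : Walk (suc (dist u + dist v)) v v
      W = symm uv ∷ reverse-append (proj₂ (fromStar (conn r u))) (proj₂ (fromStar (conn r v)))

    proper : IsColouring G f
    proper u v uv fu≡fv with 2 ∣? dist u | 2 ∣? dist v
    ... | yes 2∣u | yes 2∣v = 2∤1+even (∣m∣n⇒∣m+n 2∣u 2∣v) (total-odd u v uv)
    ... | no  2∤u | no  2∤v = 2∤v (∣m+n∣m⇒∣n (total-odd u v uv) (2∤⇒2∣suc _ 2∤u))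

  -- Critical vertex sets.

  ColourableOn : ℕ → Subset n → Set
  ColourableOn d S =
    Σ[ f ∈ (Fin n → Fin d) ] (∀ {u v} → u ∈ S → v ∈ S → Adj u v → f u ≢ f v)

  -- The double negation lets induction on the size find a critical set without deciding
  -- `ColourableOn`; it is harmless because all uses end in negated or decidable statements.
  Critical : ℕ → Subset n → Set
  Critical d S = ¬ ColourableOn d S × (∀ {x} → x ∈ S → ¬ ¬ ColourableOn d (S - x))

  no-critical⇒colourable : ∀ {d} → (∀ S → ¬ Critical d S) → ∀ S → ¬ ¬ ColourableOn d S
  no-critical⇒colourable {d} none S =
    <-rec (λ k → ∀ S → ∣ S ∣ ≡ k → ¬ ¬ ColourableOn d S)
      (λ { _ IH S refl ¬col → none S
           (¬col , λ x∈S → IH (x∈p⇒∣p-x∣<∣p∣ x∈S) (S - _) refl) })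
      ∣ S ∣ S refl

  module _ {d S} (critical : Critical d S) where

    private
      ¬col = proj₁ critical

      recolour : (Fin n → Fin d) → Fin n → Fin d → Fin n → Fin d
      recolour f x k z with z Fin.≟ x
      ... | yes _ = k
      ... | no  _ = f z

      recolour-proper : ∀ {x k} ((f , _) : ColourableOn d (S - x)) →
        (∀ {z} → z ∈ S → Adj x z → f z ≢ k) → ColourableOn d S
      recolour-proper {x} {k} (f , f-proper) free = recolour f x k , proper
        where
        proper : ∀ {u v} → u ∈ S → v ∈ S → Adj u v → recolour f x k u ≢ recolour f x k v
        proper {u} {v} u∈ v∈ uv with u Fin.≟ x | v Fin.≟ x
        ... | yes refl | yes refl = contradiction uv (irrefl refl)
        ... | yes refl | no  _    = ≢-sym (free v∈ uv)
        ... | no  _    | yes refl = free u∈ (symm uv)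
        ... | no  u≢x  | no  v≢x  =
          f-proper (x∈p∧x≢y⇒x∈p-y u∈ u≢x) (x∈p∧x≢y⇒x∈p-y v∈ v≢x) uv

    -- In a colouring of `S - x` every colour occurs on a neighbour of `x`, as otherwise `x` could
    -- take it. One neighbour of each colour gives `d` distinct ones.
    critical-neighbours : ∀ {x} → x ∈ S →
      ¬ ¬ (Σ[ u ∈ (Fin d → Fin n) ] Injective _≡_ _≡_ u × (∀ i → u i ∈ S × Adj x (u i)))
    critical-neighbours {x} x∈S goal = proj₂ critical x∈S λ col@(f , _) → goal (
      let nbr : ∀ k → ∃[ z ] z ∈ S × Adj x z × f z ≡ k
          nbr k = decidable-stable
            (any? λ z → (z ∈? S) ×-dec adj? x z ×-dec (f z Fin.≟ k))
            λ none → ¬col (recolour-proper col λ z∈S xz fz≡k → none (_ , z∈S , xz , fz≡k))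
          f-nbr = λ k → proj₂ (proj₂ (proj₂ (nbr k)))
      in proj₁ ∘ nbr ,
         (λ {i} {j} eq → trans (sym (f-nbr i)) (trans (cong f eq) (f-nbr j))) ,
         λ k → proj₁ (proj₂ (nbr k)) , proj₁ (proj₂ (proj₂ (nbr k))))

    -- Otherwise, in a colouring of `S - u`, the colour of `v` would be free for `u`: all neighbours
    -- of `u` are neighbours of `v`.
    critical-undominated : ∀ {u v} → u ∈ S → v ∈ S → u ≢ v →
      ¬ (∀ {z} → z ∈ S → Adj u z → Adj v z)
    critical-undominated {u} {v} u∈S v∈S u≢v dom = proj₂ critical u∈S λ col@(f , f-proper) →
      ¬col (recolour-proper {k = f v} col λ {z} z∈S uz → ≢-sym (f-proper
        (x∈p∧x≢y⇒x∈p-y v∈S (≢-sym u≢v))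
        (x∈p∧x≢y⇒x∈p-y z∈S (λ z≡u → irrefl (sym z≡u) uz))
        (dom z∈S uz)))

  -- Longest paths and their rotations.

  record IsPath (S : Subset n) (N : ℕ) (v : ℕ → Fin n) : Set where
    field
      inside    : ∀ {i} → i ≤ N → v i ∈ S
      injective : ∀ {i j} → i ≤ N → j ≤ N → v i ≡ v j → i ≡ j
      step      : ∀ {i} → i < N → Adj (v i) (v (suc i))

  open IsPath

  path-length< : ∀ {S N v} → IsPath S N v → N < n
  path-length< {v = v} p = injective⇒≤ {f = v ∘ toℕ}
    (toℕ-injective ∘ injective p (s≤s⁻¹ (toℕ<n _)) (s≤s⁻¹ (toℕ<n _)))

  -- If every path length could be increased by one, there would be a path with `n` edges, too many
  -- for `n` vertices.
  longest-path : ∀ {S x} → x ∈ S →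
    ¬ ¬ (∃[ N ] ∃ (IsPath S N) × (∀ v → ¬ IsPath S (suc N) v))
  longest-path {S} {x} x∈S none = paths n λ (_ , p) → <-irrefl refl (path-length< p)
    where
    paths : ∀ N → ¬ ¬ (∃ (IsPath S N))
    paths zero    k = k ((λ _ → x) , record
      { inside = λ _ → x∈S ; injective = λ { z≤n z≤n _ → refl } ; step = λ () })
    paths (suc N) k = paths N λ p → none (N , p , λ v q → k (v , q))

  _◁_ : Fin n → (ℕ → Fin n) → ℕ → Fin n
  (x ◁ v) zero    = x
  (x ◁ v) (suc i) = v i

  ◁-path : ∀ {S N v x} → IsPath S N v → x ∈ S → Adj x (v 0) →
           (∀ {i} → i ≤ N → v i ≢ x) → IsPath S (suc N) (x ◁ v)
  ◁-path p x∈S xv new .inside {zero}  _       = x∈S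
  ◁-path p x∈S xv new .inside {suc i} (s≤s i≤) = inside p i≤
  ◁-path p x∈S xv new .injective {zero}  {zero}  _ _ _ = refl
  ◁-path p x∈S xv new .injective {zero}  {suc j} _ (s≤s j≤) eq = contradiction (sym eq) (new j≤)
  ◁-path p x∈S xv new .injective {suc i} {zero}  (s≤s i≤) _ eq = contradiction eq (new i≤)
  ◁-path p x∈S xv new .injective {suc i} {suc j} (s≤s i≤) (s≤s j≤) eq =
    cong suc (injective p i≤ j≤ eq)
  ◁-path p x∈S xv new .step {zero}  _        = xv
  ◁-path p x∈S xv new .step {suc i} (s≤s i<) = step p i<

  -- The Pósa rotation: the first `suc a` vertices are reversed, so the sequence starts at `v a` and
  -- joins `v 0` to `v (suc a)`.
  rotate : ℕ → (ℕ → Fin n) → ℕ → Fin n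
  rotate a v i with i ≤? a
  ... | yes _ = v (a ∸ i)
  ... | no  _ = v i

  rotate-≤ : ∀ {a v i} → i ≤ a → rotate a v i ≡ v (a ∸ i)
  rotate-≤ {a} {v} {i} i≤a with i ≤? a
  ... | yes _   = refl
  ... | no  i≰a = contradiction i≤a i≰a

  rotate-> : ∀ {a v i} → a < i → rotate a v i ≡ v i
  rotate-> {a} {v} {i} a<i with i ≤? a
  ... | yes i≤a = contradiction i≤a (<⇒≱ a<i)
  ... | no  _   = refl

  rotate-path : ∀ {S N v a} → IsPath S N v → suc a ≤ N → Adj (v 0) (v (suc a)) →
                IsPath S N (rotate a v)
  rotate-path {S} {N} {v} {a} p a<N chord = record
    { inside = inside′ ; injective = injective′ ; step = step′ }
    where
    a≤N = <⇒≤ a<N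

    inside′ : ∀ {i} → i ≤ N → rotate a v i ∈ S
    inside′ {i} i≤N with i ≤? a
    ... | yes _ = inside p (≤-trans (m∸n≤m a i) a≤N)
    ... | no  _ = inside p i≤N

    injective′ : ∀ {i j} → i ≤ N → j ≤ N → rotate a v i ≡ rotate a v j → i ≡ j
    injective′ {i} {j} i≤N j≤N eq with i ≤? a | j ≤? a
    ... | yes i≤a | yes j≤a = ∸-cancelˡ-≡ i≤a j≤a
      (injective p (≤-trans (m∸n≤m a i) a≤N) (≤-trans (m∸n≤m a j) a≤N) eq)
    ... | yes _   | no  j≰a = contradiction
      (subst (_≤ a) (injective p (≤-trans (m∸n≤m a i) a≤N) j≤N eq) (m∸n≤m a i)) j≰a
    ... | no  i≰a | yes _   = contradiction
      (subst (_≤ a) (sym (injective p i≤N (≤-trans (m∸n≤m a j) a≤N) eq)) (m∸n≤m a j)) i≰a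
    ... | no  _   | no  _   = injective p i≤N j≤N eq

    step′ : ∀ {i} → i < N → Adj (rotate a v i) (rotate a v (suc i))
    step′ {i} i<N with <-cmp i a
    ... | tri< i<a _ _ = subst₂ Adj
      (trans (cong v (sym (+-∸-assoc 1 i<a))) (sym (rotate-≤ (<⇒≤ i<a))))
      (sym (rotate-≤ i<a))
      (symm (step p (≤-<-trans (m∸n≤m a (suc i)) a<N)))
    ... | tri≈ _ refl _ = subst₂ Adj
      (sym (trans (rotate-≤ (≤-refl {i})) (cong v (n∸n≡0 i)))) (sym (rotate-> {i} {v} ≤-refl)) chord
    ... | tri> _ _ a<i = subst₂ Adj
      (sym (rotate-> a<i)) (sym (rotate-> (m≤n⇒m≤1+n a<i))) (step p i<N)

  -- Positions of the neighbours of the end of a longest path.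

  module LongestPaths
    {d S} (critical : Critical d S) (4≤d : 4 ≤ d) (∣L∣≤d : ∣L∣ G ≤ d)
    {N} (longest : ∀ v → ¬ IsPath S (suc N) v)
    where

    -- Since `N` is fixed and `longest` concerns all sequences, rotated paths are again longest and
    -- every lemma below applies to them.
    Path : (ℕ → Fin n) → Set
    Path = IsPath S N

    -- Cycle lengths are shifted by 2 and positions of neighbours of v₀ by 1.
    T : ℕ → Set
    T t = L G (2 + t)

    A : (ℕ → Fin n) → ℕ → Set
    A v a = suc a ≤ N × Adj (v 0) (v (suc a))

    A? : ∀ v a → Dec (A v a)
    A? v a = (suc a ≤? N) ×-dec adj? (v 0) (v (suc a))

    -- A neighbour of `v 0` in `S` off the path could be put in front of it.
    neighbour-on-path : ∀ {v x} → Path v → x ∈ S → Adj (v 0) x → ∃[ a ] A v a × v (suc a) ≡ x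
    neighbour-on-path {v} {x} p x∈S vx
      with any? {n = suc N} (λ i → v (toℕ i) Fin.≟ x)
    ... | yes (0F , refl)     = contradiction vx (irrefl refl)
    ... | yes (sucF i , refl) = toℕ i , (toℕ<n i , vx) , refl
    ... | no  new             = contradiction
      (◁-path p x∈S (symm vx) λ {i} i≤N vi≡x →
        new (fromℕ< (s≤s i≤N) , trans (cong v (toℕ-fromℕ< (s≤s i≤N))) vi≡x))
      (longest _)

    positions : ∀ {v} → Path v → ¬ ¬ (Σ[ a ∈ (Fin d → ℕ) ] Injective _≡_ _≡_ a × (∀ i → A v (a i)))
    positions {v} p goal = critical-neighbours critical (inside p z≤n) λ (u , u-inj , u-nbr) →
      let pos = λ i → neighbour-on-path p (proj₁ (u-nbr i)) (proj₂ (u-nbr i))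
          v-pos = λ i → proj₂ (proj₂ (pos i))
      in goal (proj₁ ∘ pos ,
        (λ {i} {j} eq → u-inj (trans (sym (v-pos i)) (trans (cong (v ∘ suc) eq) (v-pos j)))) ,
        λ i → proj₁ (proj₂ (pos i)))

    avoiding : ∀ {v} → Path v → ∀ xs → length xs < d → ¬ ¬ (∃[ a ] A v a × a List.∉ xs)
    avoiding p xs xs<d none = positions p λ (a , a-inj , a∈A) →
      <⇒≱ xs<d (injection⇒≤length a-inj λ i →
        decidable-stable (a i ∈ᴸ? xs) λ ai∉xs → none (a i , a∈A i , ai∉xs))

    0∈A : ∀ {v a} → Path v → A v a → A v 0
    0∈A p (a<N , _) = ≤-trans (s≤s z≤n) a<N , step p (≤-trans (s≤s z≤n) a<N)

    cycle-along : ∀ {v} → Path v → ∀ k (κ : ℕ → ℕ) → 2 ≤ k →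
      (∀ {i} → i ≤ k → κ i ≤ N) →
      (∀ {i j} → i ≤ k → j ≤ k → κ i ≡ κ j → i ≡ j) →
      (∀ {i} → i < k → Adj (v (κ i)) (v (κ (suc i)))) →
      Adj (v (κ k)) (v (κ 0)) → L G (suc k)
    cycle-along {v} p k κ 2≤k κ≤ κ-inj =
      cycle k (v ∘ κ) 2≤k λ i≤ j≤ → κ-inj i≤ j≤ ∘ injective p (κ≤ i≤) (κ≤ j≤)

    -- The cycle v₀ vₐ₊₁ … vₐ₊ₖ₊₂.
    difference : ∀ {v a k} → Path v → A v a → A v (a + suc k) → T (suc k)
    difference {v} {a} {k} p (a<N , va) (b<N , vb) =
      cycle-along p (2 + k) κ (s≤s (s≤s z≤n)) κ≤ κ-inj step′ (symm vb)
      where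
      κ : ℕ → ℕ
      κ zero    = 0
      κ (suc i) = suc (a + i)

      κ≤ : ∀ {i} → i ≤ 2 + k → κ i ≤ N
      κ≤ {zero}  _        = z≤n
      κ≤ {suc i} (s≤s i≤) = ≤-trans (s≤s (+-monoʳ-≤ a i≤)) b<N

      κ-inj : ∀ {i j} → i ≤ 2 + k → j ≤ 2 + k → κ i ≡ κ j → i ≡ j
      κ-inj {zero}  {zero}  _ _ _  = refl
      κ-inj {suc i} {suc j} _ _ eq = cong suc (+-cancelˡ-≡ a i j (suc-injective eq))

      step′ : ∀ {i} → i < 2 + k → Adj (v (κ i)) (v (κ (suc i)))
      step′ {zero}  _        = subst (Adj (v 0) ∘ v ∘ suc) (sym (+-identityʳ a)) va
      step′ {suc i} (s≤s i<) = subst (λ j → Adj (v (suc (a + i))) (v (suc j))) (sym (+-suc a i))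
        (step p (≤-trans (s≤s (+-monoʳ-< a i<)) b<N))

    -- The cycle v₀ vₛ₊₁ vₛ v_{b+1} … v_{b+k+1}.
    twisted : ∀ {v s b k} → Path v → 0 < s → s < b → A v s →
              Adj (v s) (v (suc b)) → A v (b + k) → T (2 + k)
    twisted {v} {s} {b} {k} p 0<s s<b (s<N , v0s) vsb (c<N , v0c) =
      cycle-along p (3 + k) κ (s≤s (s≤s z≤n)) κ≤ κ-inj step′ (symm v0c)
      where
      κ : ℕ → ℕ
      κ 0                   = 0
      κ 1                   = suc s
      κ 2                   = s
      κ (suc (suc (suc i))) = suc (b + i)

      κ≤ : ∀ {i} → i ≤ 3 + k → κ i ≤ N
      κ≤ {0}                   _                    = z≤n
      κ≤ {1}                   _                    = s<N
      κ≤ {2}                   _                    = <⇒≤ s<N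
      κ≤ {suc (suc (suc i))} (s≤s (s≤s (s≤s i≤k))) = ≤-trans (s≤s (+-monoʳ-≤ b i≤k)) c<N

      s<b+ : ∀ i → s < b + i
      s<b+ i = <-≤-trans s<b (m≤m+n b i)

      κ-inj : ∀ {i j} → i ≤ 3 + k → j ≤ 3 + k → κ i ≡ κ j → i ≡ j
      κ-inj {0} {0} _ _ _ = refl
      κ-inj {0} {2} _ _ eq = contradiction eq (<⇒≢ 0<s)
      κ-inj {1} {1} _ _ _ = refl
      κ-inj {1} {2} _ _ eq = contradiction eq 1+n≢n
      κ-inj {1} {suc (suc (suc j))} _ _ eq =
        contradiction (suc-injective eq) (<⇒≢ (s<b+ j))
      κ-inj {2} {0} _ _ eq = contradiction (sym eq) (<⇒≢ 0<s)
      κ-inj {2} {1} _ _ eq = contradiction (sym eq) 1+n≢n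
      κ-inj {2} {2} _ _ _ = refl
      κ-inj {2} {suc (suc (suc j))} _ _ eq =
        contradiction eq (<⇒≢ (m≤n⇒m≤1+n (s<b+ j)))
      κ-inj {suc (suc (suc i))} {1} _ _ eq =
        contradiction (sym (suc-injective eq)) (<⇒≢ (s<b+ i))
      κ-inj {suc (suc (suc i))} {2} _ _ eq =
        contradiction (sym eq) (<⇒≢ (m≤n⇒m≤1+n (s<b+ i)))
      κ-inj {suc (suc (suc i))} {suc (suc (suc j))} _ _ eq =
        cong (3 +_) (+-cancelˡ-≡ b i j (suc-injective eq))

      step′ : ∀ {i} → i < 3 + k → Adj (v (κ i)) (v (κ (suc i)))
      step′ {0} _ = v0s
      step′ {1} _ = symm (step p s<N)
      step′ {2} _ = subst (Adj (v s) ∘ v ∘ suc) (sym (+-identityʳ b)) vsb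
      step′ {suc (suc (suc i))} (s≤s (s≤s (s≤s i<k))) =
        subst (λ j → Adj (v (suc (b + i))) (v (suc j))) (sym (+-suc b i))
          (step p (≤-trans (s≤s (+-monoʳ-< b i<k)) c<N))

    -- The cycle v₀ … vₛ v_{s+e+1} … v_{s+e+k+2}.
    shortcut : ∀ {v s e k} → Path v → Adj (v s) (v (suc (e + s))) →
               A v (e + s + suc k) → T (s + suc k)
    shortcut {v} {s} {e} {k} p vsb (c<N , v0c) =
      cycle-along p (suc (s + suc k)) κ (s≤s (≤-trans (s≤s z≤n) (m≤n+m (suc k) s))) κ≤ κ-inj step′
        (subst₂ (λ x y → Adj (v x) (v y)) (sym κ-last) (sym (κ-≤ {0} z≤n)) (symm v0c))
      where
      κ : ℕ → ℕ
      κ i with i ≤? s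
      ... | yes _ = i
      ... | no  _ = e + i

      κ-≤ : ∀ {i} → i ≤ s → κ i ≡ i
      κ-≤ {i} i≤s with i ≤? s
      ... | yes _   = refl
      ... | no  i≰s = contradiction i≤s i≰s

      κ-> : ∀ {i} → s < i → κ i ≡ e + i
      κ-> {i} s<i with i ≤? s
      ... | yes i≤s = contradiction i≤s (<⇒≱ s<i)
      ... | no  _   = refl

      last : e + suc (s + suc k) ≡ suc (e + s + suc k)
      last = trans (+-suc e _) (cong suc (sym (+-assoc e s (suc k))))

      κ-last : κ (suc (s + suc k)) ≡ suc (e + s + suc k)
      κ-last = trans (κ-> (s≤s (m≤m+n s (suc k)))) last

      e+≤N : ∀ {i} → i ≤ suc (s + suc k) → e + i ≤ N
      e+≤N i≤ = ≤-trans (+-monoʳ-≤ e i≤) (subst (_≤ N) (sym last) c<N)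

      κ≤ : ∀ {i} → i ≤ suc (s + suc k) → κ i ≤ N
      κ≤ {i} i≤ with i ≤? s
      ... | yes _ = ≤-trans (m≤n+m i e) (e+≤N i≤)
      ... | no  _ = e+≤N i≤

      κ-inj : ∀ {i j} → i ≤ suc (s + suc k) → j ≤ suc (s + suc k) → κ i ≡ κ j → i ≡ j
      κ-inj {i} {j} _ _ eq with i ≤? s | j ≤? s
      ... | yes _   | yes _   = eq
      ... | yes i≤s | no  j≰s = contradiction (≤-trans (m≤n+m j e) (subst (_≤ s) eq i≤s)) j≰s
      ... | no  i≰s | yes j≤s = contradiction (≤-trans (m≤n+m i e) (subst (_≤ s) (sym eq) j≤s)) i≰s
      ... | no  _   | no  _   = +-cancelˡ-≡ e i j eq

      step′ : ∀ {i} → i < suc (s + suc k) → Adj (v (κ i)) (v (κ (suc i)))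
      step′ {i} i< with <-cmp i s
      ... | tri< i<s _ _ = subst₂ (λ x y → Adj (v x) (v y)) (sym (κ-≤ (<⇒≤ i<s))) (sym (κ-≤ i<s))
        (step p (≤-trans (s≤s (m≤n+m i e)) (subst (_≤ N) (+-suc e i) (e+≤N i<))))
      ... | tri≈ _ refl _ = subst₂ (λ x y → Adj (v x) (v y))
        (sym (κ-≤ ≤-refl)) (sym (trans (κ-> ≤-refl) (+-suc e i))) vsb
      ... | tri> _ _ s<i = subst₂ (λ x y → Adj (v x) (v y))
        (sym (κ-> s<i)) (sym (trans (κ-> (m≤n⇒m≤1+n s<i)) (+-suc e i)))
        (step p (subst (_≤ N) (+-suc e i) (e+≤N i<)))

    A⇒T : ∀ {v a} → Path v → 0 < a → A v a → T a
    A⇒T {a = suc a} p _ a∈A = difference p (0∈A p a∈A) a∈A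

    A⇒0⊎T : ∀ {v a} → Path v → A v a → a ≡ 0 ⊎ T a
    A⇒0⊎T {a = zero}  p _   = inj₁ refl
    A⇒0⊎T {a = suc a} p a∈A = inj₂ (A⇒T p (s≤s z≤n) a∈A)

    -- The `d` elements of `A v` together with `x` and `y` would be `2 + d` distinct elements of `T`
    -- or 0, but there are at most `suc (∣L∣ G)`, hence at most `suc d`, of these.
    omits-at-most-one : ∀ {v x y} → Path v → T x → ¬ A v x → T y → ¬ A v y → ¬ x ≢ y
    omits-at-most-one {v} {x} {y} p Tx x∉A Ty y∉A x≢y = positions p λ (a , a-inj , a∈A) →
      <⇒≱ (s≤s (s≤s ∣L∣≤d)) (∣L∣-bound {f = x ∷ᶠ y ∷ᶠ a}
        (∷-injective
          (λ { 0F → x≢y ; (sucF i) x≡a → x∉A (subst (A v) (sym x≡a) (a∈A i)) })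
          (∷-injective (λ i y≡a → y∉A (subst (A v) (sym y≡a) (a∈A i))) a-inj))
        (λ { 0F → inj₂ Tx ; (sucF 0F) → inj₂ Ty ; (sucF (sucF i)) → A⇒0⊎T p (a∈A i) }))

    all-but : ∀ {v x y} → Path v → T x → ¬ A v x → T y → y ≢ x → A v y
    all-but {v} {x} {y} p Tx x∉A Ty y≢x = decidable-stable (A? v y) λ y∉A →
      omits-at-most-one {v} p Tx x∉A Ty y∉A (≢-sym y≢x)

    difference′ : ∀ {v a b} → Path v → A v a → A v b → a < b → T (b ∸ a)
    difference′ {v} {a} {b} p a∈A b∈A a<b with k , refl ← m≤n⇒∃[o]m+o≡n a<b =
      subst T (sym (trans (cong (_∸ a) (sym (+-suc a k))) (m+n∸m≡n a (suc k))))
        (difference {v} p a∈A (subst (A v) (sym (+-suc a k)) b∈A))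

    rot : ∀ {v a} → Path v → A v a → Path (rotate a v)
    rot p (a<N , va) = rotate-path p a<N va

    rotate-0 : ∀ a v → rotate a v 0 ≡ v a
    rotate-0 a v = rotate-≤ {a} {v} z≤n

    -- The end of the rotated path is `v a`. Its neighbours beyond the reversed part keep their
    -- positions; the others, in `A-rotate-<`, are read backwards.
    A-rotate-≥ : ∀ {v a b} → a ≤ b → A (rotate a v) b → Adj (v a) (v (suc b))
    A-rotate-≥ {v} {a} a≤b (_ , ab) = subst₂ Adj (rotate-0 a v) (rotate-> (s≤s a≤b)) ab

    A-rotate-< : ∀ {v a b} → b < a → A (rotate a v) b → Adj (v a) (v (a ∸ suc b))
    A-rotate-< {v} {a} b<a (_ , ab) = subst₂ Adj (rotate-0 a v) (rotate-≤ b<a) ab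

    -- All neighbours of `v a` in `S` lie on the rotated path, so `above` and `below` together would
    -- make each of them a neighbour of `v 0`.
    undominated : ∀ {v a} → Path v → 0 < a → A v a →
      (∀ {b} → a ≤ b → A (rotate a v) b → A v b) →
      ¬ (∀ {b} → b < a → A (rotate a v) b → Adj (v 0) (v (a ∸ suc b)))
    undominated {v} {a} p 0<a a∈A@(a<N , _) above below =
      critical-undominated critical (inside p (<⇒≤ a<N)) (inside p z≤n)
        (λ eq → <⇒≢ 0<a (sym (injective p (<⇒≤ a<N) z≤n eq)))
        dominated
      where
      dominated : ∀ {z} → z ∈ S → Adj (v a) z → Adj (v 0) z
      dominated z∈S az
        with b , b∈A′ , refl ← neighbour-on-path (rot p a∈A) z∈S
               (subst (λ x → Adj x _) (sym (rotate-0 a v)) az)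
        with a ≤? b
      ... | yes a≤b = subst (Adj (v 0)) (sym (rotate-> (s≤s a≤b))) (proj₂ (above a≤b b∈A′))
      ... | no  a≰b = subst (Adj (v 0)) (sym (rotate-≤ (≰⇒> a≰b))) (below (≰⇒> a≰b) b∈A′)

    -- Besides 0, `A v` has at least three elements because `4 ≤ d`. Only `s` is chosen least; `b`
    -- and `c` are any two others in increasing order.
    three-least : ∀ {v} → Path v → ¬ ¬ (∃[ s ] ∃[ b ] ∃[ c ] 0 < s × s < b × b < c ×
      A v s × A v b × A v c × (∀ {j} → A v j → 0 < j → s ≤ j))
    three-least {v} p goal =
      avoiding p (0 ∷ []) (≤-trans (s≤s (s≤s z≤n)) 4≤d) λ (a , a∈A , a∉) →
      case least (λ j → A? v j ×-dec (0 <? j)) a (a∈A , n≢0⇒n>0 (a∉ ∘ here)) of λ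
        (s , (s∈A , 0<s) , s≤) →
      avoiding p (0 ∷ s ∷ []) (≤-trans (s≤s (s≤s (s≤s z≤n))) 4≤d) λ (b , b∈A , b∉) →
      avoiding p (0 ∷ s ∷ b ∷ []) 4≤d λ (c , c∈A , c∉) →
      let s<b = ≤∧≢⇒< (s≤ b (b∈A , n≢0⇒n>0 (b∉ ∘ here))) (b∉ ∘ there ∘ here ∘ sym)
          s<c = ≤∧≢⇒< (s≤ c (c∈A , n≢0⇒n>0 (c∉ ∘ here))) (c∉ ∘ there ∘ here ∘ sym)
          s-least = λ {j} j∈A 0<j → s≤ j (j∈A , 0<j)
      in case <-cmp b c of λ where
        (tri< b<c _ _) → goal (s , b , c , 0<s , s<b , b<c , s∈A , b∈A , c∈A , s-least)
        (tri≈ _ b≡c _) → c∉ (there (there (here (sym b≡c))))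
        (tri> _ _ c<b) → goal (s , c , b , 0<s , s<c , c<b , s∈A , c∈A , b∈A , s-least)

    -- If `b` or `c` is also in `A (rotate s v)`, then `twisted` with `k = 0` is a 4-cycle.
    -- Otherwise the rotated path omits two elements of `T`.
    2∈T : ∀ {v} → Path v → T 2
    2∈T {v} p = decidable-stable (L? G 4) λ 2∉T → three-least p
      λ (s , b , c , 0<s , s<b , b<c , s∈A , b∈A , c∈A , _) →
      let p′ = rot p s∈A
          quadrilateral : ∀ {x} → s < x → A v x → A (rotate s v) x → T 2
          quadrilateral s<x x∈A x∈A′ = twisted p 0<s s<x s∈A (A-rotate-≥ (<⇒≤ s<x) x∈A′)
            (subst (A v) (sym (+-identityʳ _)) x∈A)
          0<b = <-trans 0<s s<b
      in omits-at-most-one p′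
           (A⇒T p 0<b b∈A) (2∉T ∘ quadrilateral s<b b∈A)
           (A⇒T p (<-trans 0<b b<c) c∈A) (2∉T ∘ quadrilateral (<-trans s<b b<c) c∈A)
           (<⇒≢ b<c)

    -- Graphs with a triangle: the longest path begins with a large clique.

    module Triangle (1∈T : T 1) where

      -- Such a gap would make `v 0` dominate `v (suc e)`: later neighbours of the latter have
      -- positions in `T` other than `e`, hence in `A v`, and earlier vertices other than `v 0` are
      -- all neighbours of `v 0`.
      no-gap : ∀ {v e} → Path v → T e → ¬ A v e → A v (suc e) → ¬ (∀ {j} → j < e → A v j)
      no-gap {v} {e} p Te e∉A e+1∈A@(e+1<N , _) j∈A = undominated p (s≤s z≤n) e+1∈A above below
        where
        above : ∀ {b} → suc e ≤ b → A (rotate (suc e) v) b → A v b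
        above e<b b∈A′ = all-but p Te e∉A
          (A⇒T (rot p e+1∈A) (≤-<-trans z≤n e<b) b∈A′) (≢-sym (<⇒≢ e<b))

        below : ∀ {b} → b < suc e → A (rotate (suc e) v) b → Adj (v 0) (v (suc e ∸ suc b))
        below {b} b≤e b∈A′ with m≤n⇒m<n∨m≡n (s≤s⁻¹ b≤e)
        ... | inj₁ b<e  = subst (Adj (v 0) ∘ v) (sym (+-∸-assoc 1 b<e))
          (proj₂ (j∈A (m∸n<n b<e)))
          where
          m∸n<n : ∀ {b e} → b < e → e ∸ suc b < e
          m∸n<n {b} {suc e} _ = s≤s (m∸n≤m e b)
        -- Here the neighbour is `v 0` itself, so `e` would be in `A v`.
        ... | inj₂ refl = contradiction
          (<⇒≤ e+1<N , symm (subst (Adj (v (suc e)) ∘ v) (n∸n≡0 e) (A-rotate-< ≤-refl b∈A′)))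
          e∉A

      1∈A : ∀ {v} → Path v → A v 1
      1∈A {v} p = decidable-stable (A? v 1) λ 1∉A →
        let 2∈A = all-but p 1∈T 1∉A (2∈T p) λ ()
        in no-gap p 1∈T 1∉A 2∈A λ { (s≤s z≤n) → 0∈A p 2∈A }

      -- Beyond the first case, 2 is in `A v`, and its difference from `3 + t` is `1 + t`, which is
      -- not the one omitted element.
      before-gap : ∀ {v t} → Path v → T (2 + t) → ¬ A v (2 + t) → A v (3 + t) → A v (1 + t)
      before-gap {t = zero}  p _  _   _     = 1∈A p
      before-gap {t = suc t} p Tt t∉A t+1∈A = all-but p Tt t∉A
        (difference p (all-but p Tt t∉A (2∈T p) λ ()) t+1∈A) (<⇒≢ ≤-refl)

      below-gap : ∀ {v e i} → Path v → T e → ¬ A v e → i < e → A v (suc i) → A v i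
      below-gap {i = zero}  p Te e∉A _   1∈A   = 0∈A p 1∈A
      below-gap {i = suc i} p Te e∉A i<e i+1∈A =
        all-but p Te e∉A (difference p (1∈A p) i+1∈A) (<⇒≢ i<e)

      -- If the predecessor were missing, `before-gap` and then repeated `below-gap` would put
      -- everything smaller in `A v`, contrary to `no-gap`.
      pred-closed : ∀ {v t} → Path v → A v (suc t) → A v t
      pred-closed         {t = zero}        p t+1∈A = 0∈A p t+1∈A
      pred-closed         {t = suc zero}    p t+1∈A = 1∈A p
      pred-closed {v} {t = suc (suc t)}     p t+1∈A = decidable-stable (A? v _) λ t∉A →
        let Tt = difference p (1∈A p) t+1∈A
        in no-gap p Tt t∉A t+1∈A λ j<t →
          descend {A v} (λ i<1+t → below-gap p Tt t∉A (m≤n⇒m≤1+n i<1+t))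
            (before-gap p Tt t∉A t+1∈A) (s≤s⁻¹ j<t)

      -- `A v` is closed downwards, so if it missed `k` its `d` elements would all lie below `k`.
      initial : ∀ {v k} → Path v → k < d → A v k
      initial {v} {k} p k<d = decidable-stable (A? v k) λ k∉A → positions p
        λ (a , a-inj , a∈A) → <⇒≱ k<d (subst (d ≤_) (length-upTo k)
          (injection⇒≤length a-inj λ i →
            ∈-upTo⁺ (≰⇒> λ k≤ai → k∉A (descend {A v} (λ _ → pred-closed p) (a∈A i) k≤ai))))

      -- By `initial` the path can be rotated at `i`; `initial` for the rotated path, which starts
      -- at `v i`, gives the edge.
      clique : ∀ {v i j} → Path v → i < j → j ≤ d → Adj (v i) (v j)
      clique p (s≤s i≤j) j<d =
        A-rotate-≥ i≤j (initial (rot p (initial p (≤-<-trans i≤j j<d))) j<d)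

      d<w : ∀ {v} → Path v → d < w G
      d<w {v} p = clique⇒≤w (v ∘ toℕ) λ i j i≢j → case <-cmp (toℕ i) (toℕ j) of λ where
        (tri< i<j _ _) → clique p i<j (s≤s⁻¹ (toℕ<n j))
        (tri≈ _ i≡j _) → contradiction (toℕ-injective i≡j) i≢j
        (tri> _ _ j<i) → symm (clique p j<i (s≤s⁻¹ (toℕ<n i)))

    -- Triangle-free graphs: all cycle lengths are even.

    module TriangleFree (1∉T : ¬ T 1) where

      0∉T : ¬ T 0
      0∉T = (λ { (s≤s (s≤s ())) }) ∘ L⇒3≤

      T⇒3≤ : ∀ {t} → T t → t ≢ 2 → 3 ≤ t
      T⇒3≤ {0}                 Tt t≢2 = contradiction Tt 0∉T
      T⇒3≤ {1}                 Tt t≢2 = contradiction Tt 1∉T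
      T⇒3≤ {2}                 Tt t≢2 = contradiction refl t≢2
      T⇒3≤ {suc (suc (suc t))} Tt t≢2 = s≤s (s≤s (s≤s z≤n))

      2∣2+ : ∀ {t} → 2 ∣ t → 2 ∣ 2 + t
      2∣2+ = ∣m∣n⇒∣m+n {m = 2} (divides 1 refl)

      -- Since the differences of A with 2 lie in T, all odd elements of T descend to e;
      -- this is incompatible with e ∈ A′ for the rotated path.
      module Gap {v o e} (p : Path v) (To : T o) (2∤o : 2 ∤ o) (2∈A : A v 2)
                 (Te : T e) (e∉A : ¬ A v e) (e∈A′ : A (rotate 2 v) e) where

        p′ : Path (rotate 2 v)
        p′ = rot p 2∈A

        -- An odd `t` in `T` other than `e` is in `A v`, so `t − 2` is in `T`. As 1 is not in `T`,
        -- this descent can only stop at `e`.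
        least-odd : ∀ t → T t → 2 ∤ t → e ≤ t × 2 ∤ e
        least-odd = <-rec _ go
          where
          go : ∀ t → (∀ {r} → r < t → T r → 2 ∤ r → e ≤ r × 2 ∤ e) →
               T t → 2 ∤ t → e ≤ t × 2 ∤ e
          go t IH Tt 2∤t with t ≟ e
          go t IH Tt 2∤t | yes refl = ≤-refl , 2∤t
          go 0 IH Tt 2∤t | no _ = contradiction Tt 0∉T
          go 1 IH Tt 2∤t | no _ = contradiction Tt 1∉T
          go 2 IH Tt 2∤t | no _ = contradiction (divides 1 refl) 2∤t
          go (suc (suc (suc t))) IH Tt 2∤t | no t≢e =
            let e≤t , 2∤e = IH (m≤n+m _ 1)
                  (difference p 2∈A (all-but p Te e∉A Tt t≢e)) (2∤t ∘ 2∣2+)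
            in ≤-trans e≤t (m≤n+m _ 2) , 2∤e

        e-odd : 2 ∤ e
        e-odd = proj₂ (least-odd o To 2∤o)

        no-smaller-odd : ∀ {t r} → r + suc t ≡ e → 2 ∣ r → 0 < r → ¬ T (suc t)
        no-smaller-odd {t} {r} refl 2∣r 0<r Tt =
          <⇒≱ (m<n+m (suc t) 0<r) (proj₁ (least-odd _ Tt (e-odd ∘ ∣m∣n⇒∣m+n 2∣r)))

        e≢2 : e ≢ 2
        e≢2 refl = e∉A 2∈A

        2∉A′ : ¬ A (rotate 2 v) 2
        2∉A′ 2∈A′ with t , 3+t≡e ← m≤n⇒∃[o]m+o≡n (T⇒3≤ Te e≢2) =
          no-smaller-odd 3+t≡e (divides 1 refl) (s≤s z≤n)
            (difference p′ 2∈A′ (subst (A (rotate 2 v)) (sym 3+t≡e) e∈A′))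

        A′-rest : ∀ {t} → T t → t ≢ 2 → A (rotate 2 v) t
        A′-rest = all-but p′ (2∈T p) 2∉A′

        -- Otherwise 4 and `e` are both in `A (rotate 2 v)`. Their difference is 1 if `e = 3`, and
        -- an odd element of `T` below `e` if `4 < e`.
        4∉T : ¬ T 4
        4∉T T4 with <-cmp e 4
        ... | tri< e<4 _ _ with refl ← ≤-antisym (s≤s⁻¹ e<4) (T⇒3≤ Te e≢2) =
          1∉T (difference p′ e∈A′ (A′-rest T4 λ ()))
        ... | tri≈ _ refl _ = e-odd (divides 2 refl)
        ... | tri> _ _ 4<e with t , 5+t≡e ← m≤n⇒∃[o]m+o≡n 4<e =
          no-smaller-odd 5+t≡e (divides 2 refl) (s≤s z≤n)
            (difference p′ (A′-rest T4 λ ()) (subst (A (rotate 2 v)) (sym 5+t≡e) e∈A′))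

        -- A larger even `t` differs from the odd `e`, so it is in `A v` and `t − 2` is in `T`; the
        -- descent would reach 4.
        even⇒2 : ∀ t → T t → 2 ∣ t → t ≡ 2
        even⇒2 0 Tt 2∣t = contradiction Tt 0∉T
        even⇒2 1 Tt 2∣t = contradiction Tt 1∉T
        even⇒2 2 Tt 2∣t = refl
        even⇒2 3 Tt 2∣t = contradiction 2∣t (2∤1+even (divides 1 refl))
        even⇒2 4 Tt 2∣t = contradiction Tt 4∉T
        even⇒2 (suc (suc t@(suc (suc (suc _))))) Tt 2∣t =
          case even⇒2 t
            (difference p 2∈A (all-but p Te e∉A Tt λ { refl → e-odd 2∣t }))
            (∣m+n∣m⇒∣n {m = 2} 2∣t (divides 1 refl)) of λ ()

        -- Such an `x` is odd and exceeds `e`. Both lie in `A (rotate 2 v)`, so `x ∸ e` is an even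
        -- element of `T`, hence 2.
        2+e : ∀ {x} → A v x → x ≢ 0 → x ≢ 2 → x ≡ 2 + e
        2+e {x} x∈A x≢0 x≢2 = trans (sym (m∸n+n≡m (<⇒≤ e<x))) (cong (_+ e) x∸e≡2)
          where
          Tx = A⇒T p (n≢0⇒n>0 x≢0) x∈A

          x-odd : 2 ∤ x
          x-odd = x≢2 ∘ even⇒2 x Tx

          e<x : e < x
          e<x = ≤∧≢⇒< (proj₁ (least-odd x Tx x-odd)) λ { refl → e∉A x∈A }

          Tx∸e : T (x ∸ e)
          Tx∸e = difference′ p′ e∈A′ (A′-rest Tx x≢2) e<x

          x∸e≡2 : x ∸ e ≡ 2
          x∸e≡2 = even⇒2 _ Tx∸e (decidable-stable (2 ∣? (x ∸ e)) λ odd →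
            x-odd (∣m+n∣m⇒∣n {m = 2} (subst (2 ∣_) 2+x
              (∣m∣n⇒∣m+n (2∤⇒2∣suc e e-odd) (2∤⇒2∣suc _ odd))) (divides 1 refl)))
            where
            2+x : suc e + suc (x ∸ e) ≡ 2 + x
            2+x = cong suc (trans (+-suc e (x ∸ e)) (cong suc (m+[n∸m]≡n (<⇒≤ e<x))))

        absurd : ⊥
        -- Now `A v` is contained in 0, 2 and `2 + e`, yet has at least four elements.
        absurd =
          avoiding p (0 ∷ 2 ∷ []) (≤-trans (s≤s (s≤s (s≤s z≤n))) 4≤d) λ (x , x∈A , x∉) →
          avoiding p (0 ∷ 2 ∷ x ∷ []) 4≤d λ (y , y∈A , y∉) →
          y∉ (there (there (here (trans
            (2+e y∈A (y∉ ∘ here) (y∉ ∘ there ∘ here))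
            (sym (2+e x∈A (x∉ ∘ here) (x∉ ∘ there ∘ here)))))))

      -- Otherwise `v 0` would dominate `v 2`: `Gap` handles the later neighbours, and of the
      -- earlier vertices `v 1` is a neighbour of `v 0`, while `v 0` itself would create a triangle.
      2∉A : ∀ {v o} → Path v → T o → 2 ∤ o → ¬ A v 2
      2∉A {v} p To 2∤o 2∈A@(2<N , _) = undominated p (s≤s z≤n) 2∈A above below
        where
        p′ = rot p 2∈A

        above : ∀ {b} → 2 ≤ b → A (rotate 2 v) b → A v b
        above {b} 2≤b b∈A′ = decidable-stable (A? v b) λ b∉A →
          Gap.absurd p To 2∤o 2∈A (A⇒T p′ (<-trans (s≤s z≤n) 2≤b) b∈A′) b∉A b∈A′

        below : ∀ {b} → b < 2 → A (rotate 2 v) b → Adj (v 0) (v (2 ∸ suc b))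
        below {0} _ _    = step p (≤-trans (s≤s z≤n) 2<N)
        below {1} _ 1∈A′ = contradiction (A⇒T p′ (s≤s z≤n) 1∈A′) 1∉T
        below {suc (suc b)} (s≤s (s≤s ())) _

      -- With δ = c ∸ b, the three cycles give δ, 2 + δ, s + δ ∈ T; so unless δ ≡ 2,
      -- the last two lie in A and s ∸ 2 ∈ T is smaller than s, hence equal to 2.
      least≡4 : ∀ {v s b c} → Path v → (∀ {t} → T t → t ≢ 2 → A v t) →
        (A v 4 → s ≡ 4) → 3 ≤ s → s < b → b < c → Adj (v s) (v (suc b)) →
        A v s → A v b → A v c → (∀ {j} → A v j → 0 < j → s ≤ j) → s ≡ 4
      least≡4 {v} p rest 4∈A⇒ 3≤s s<b b<c vsb s∈A b∈A c∈A s-least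
        with s′ , refl ← m≤n⇒∃[o]m+o≡n 3≤s
        with e , refl ← m≤n⇒∃[o]m+o≡n (<⇒≤ s<b)
        with k , refl ← m≤n⇒∃[o]m+o≡n b<c
        = conclude
        where
        s = 3 + s′
        b = s + e

        b+δ∈A : A v (b + suc k)
        b+δ∈A = subst (A v) (sym (+-suc b k)) c∈A

        2+δ∈T : T (2 + suc k)
        2+δ∈T = twisted p (s≤s z≤n) s<b s∈A vsb b+δ∈A

        s+δ∈T : T (s + suc k)
        s+δ∈T = shortcut {e = e} p (subst (Adj (v s) ∘ v ∘ suc) (+-comm s e) vsb)
          (subst (λ x → A v (x + suc k)) (+-comm s e) b+δ∈A)

        s∸2∈T : T (suc s′)
        s∸2∈T = difference p (rest 2+δ∈T λ ())
          (subst (A v) (cong (3 +_) (trans (+-comm s′ (suc k)) (sym (+-suc k s′))))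
            (rest s+δ∈T λ ()))

        conclude : s ≡ 4
        conclude with suc k ≟ 2 | suc s′ ≟ 2
        ... | yes refl | _        = 4∈A⇒ (rest 2+δ∈T λ ())
        ... | no  _    | yes refl = refl
        ... | no  _    | no  s′≢1 = contradiction (s-least (rest s∸2∈T s′≢1) (s≤s z≤n))
          (<⇒≱ (s≤s (m≤n+m (suc s′) 1)))

      -- An odd element would force every longest path to omit 2, hence nothing else of `T`. Then
      -- `s ≡ 4`, and differences with 4 show that `T` is even after all.
      T⇒even : ∀ {v} → Path v → ∀ {t} → T t → 2 ∣ t
      T⇒even {v} p {o} To = decidable-stable (2 ∣? o) λ 2∤o → three-least p
        λ (s , b , c , 0<s , s<b , b<c , s∈A , b∈A , c∈A , s-least) →
        let rest : ∀ {u} → Path u → ∀ {t} → T t → t ≢ 2 → A u t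
            rest q = all-but q (2∈T q) (2∉A q To 2∤o)
        in 2∤o (go (2∉A p To 2∤o) (rest p) (rest (rot p s∈A))
                  0<s s<b b<c s∈A b∈A c∈A s-least o To)
        where
        go : ∀ {s b c} → ¬ A v 2 → (∀ {t} → T t → t ≢ 2 → A v t) →
             (∀ {t} → T t → t ≢ 2 → A (rotate s v) t) →
             0 < s → s < b → b < c → A v s → A v b → A v c →
             (∀ {j} → A v j → 0 < j → s ≤ j) → ∀ t → T t → 2 ∣ t
        go {s} {b} {c} 2∉A rest rest′ 0<s s<b b<c s∈A b∈A c∈A s-least = even
          where
          3≤s : 3 ≤ s
          3≤s = T⇒3≤ (A⇒T p 0<s s∈A) λ { refl → 2∉A s∈A }

          vsb : Adj (v s) (v (suc b))
          vsb = A-rotate-≥ (<⇒≤ s<b)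
            (rest′ (A⇒T p (<-trans 0<s s<b) b∈A) λ { refl → 2∉A b∈A })

          4∈A⇒s≡4 : A v 4 → s ≡ 4
          4∈A⇒s≡4 4∈A with m≤n⇒m<n∨m≡n 3≤s
          ... | inj₁ 4≤s  = ≤-antisym (s-least 4∈A (s≤s z≤n)) 4≤s
          -- With `s = 3`, the difference 4 - 3 would give a triangle.
          ... | inj₂ refl = contradiction (difference p s∈A 4∈A) 1∉T

          s≡4 : s ≡ 4
          s≡4 = least≡4 p rest 4∈A⇒s≡4 3≤s s<b b<c vsb s∈A b∈A c∈A s-least

          even : ∀ t → T t → 2 ∣ t
          even 0 Tt = divides 0 refl
          even 1 Tt = contradiction Tt 1∉T
          even 2 Tt = divides 1 refl
          even t@3 Tt = contradiction
            (subst (_≤ 3) s≡4 (s-least (rest Tt λ ()) (s≤s z≤n))) λ { (s≤s (s≤s (s≤s ()))) }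
          even 4 Tt = divides 2 refl
          -- Both 4 and the given number are in `A v`, so their difference is in `T`.
          even (suc (suc (suc (suc t@(suc _))))) Tt =
            2∣2+ (2∣2+ (even t (difference p (subst (A v) s≡4 s∈A) (rest Tt λ ()))))

-- Combining the two cases.

theorem11 : ∀ (n : ℕ) (G : Graph n) (i : ℕ) → Connected G → 4 ≤ ∣L∣ G → i ≤ 2
    → ¬ (i ≡ 0 × ∣Lₒ∣ G ≡ 3 × ∣Lₑ∣ G ≡ 2)
    → w G ≤ ∣L∣ G + i
    → χ G ≤ ∣L∣ G + i
theorem11 n G i conn 4≤∣L∣ _ _ w≤d with colourable? G (∣L∣ G + i)
... | yes colouring = proj₂ (proj₂ (fewestColours G)) _ colouring
-- From here the goal is empty, so the doubly negated critical set and longest path can be used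
-- directly.
... | no  ¬colouring = ⊥-elim (no-critical⇒colourable G none full
  λ (f , proper) → ¬colouring (f , λ u v → proper ∈⊤ ∈⊤))
  where
  d = ∣L∣ G + i

  4≤d : 4 ≤ d
  4≤d = ≤-trans 4≤∣L∣ (m≤m+n _ i)

  2≤d : 2 ≤ d
  2≤d = ≤-trans (s≤s (s≤s z≤n)) 4≤d

  none : ∀ S → ¬ Critical G d S
  none S critical with nonempty? S
  ... | no empty = proj₁ critical
    ((λ _ → Fin.inject≤ {m = 2} 0F 2≤d) , λ u∈S → contradiction (_ , u∈S) empty)
  ... | yes (x , x∈S) = longest-path G x∈S λ (N , (v , p) , longest) →
    let open LongestPaths G critical 4≤d (m≤m+n (∣L∣ G) i) longest
    in case L? G 3 of λ where
      (yes 1∈T) → <⇒≱ (Triangle.d<w 1∈T p) w≤d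
      (no  1∉T) →
        let f , proper = even-cycles⇒2-colourable G conn x λ where
              0             Ll → divides 0 refl
              1             Ll → contradiction (L⇒3≤ G Ll) λ { (s≤s ()) }
              (suc (suc t)) Tt → ∣m∣n⇒∣m+n {m = 2} (divides 1 refl) (TriangleFree.T⇒even 1∉T p Tt)
        in ¬colouring ((λ u → Fin.inject≤ (f u) 2≤d) ,
             λ u v uv → proper u v uv ∘ Fin.inject≤-injective 2≤d 2≤d _ _)
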